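{- Let $F_{4,2}$ be the $3$-graph on vertex set $\{1,\dots,6\}$ with edges $\{123, 124, 134, 156, 256, 356, 456\}$. Then $\gamma^+(F_{4,2}) = \frac{3}{5}$.
   Context: For a $3$-graph $H$, the minimum positive co-degree $\delta_2^+(H)$ is the largest $k$ such that every pair of vertices contained in some edge of $H$ is contained in at least $k$ edges (it is $0$ for the edgeless graph). For a $3$-graph $F$, $\mathrm{co^+ex}(n,F)$ is the maximum of $\delta_2^+(H)$ over $n$-vertex $3$-graphs $H$ not containing $F$ as a (not necessarily induced) subhypergraph, and $\gamma^+(F)=\lim_{n\to\infty}\mathrm{co^+ex}(n,F)/n$ (the limit exists). -}

module Defs where

open import Data.Nat using (ℕ; zero; suc; _+_; _*_; _≤_; _<_; _⊓_)
open import Data.Bool using (Bool; true; false; if_then_else_)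
open import Data.Fin using (Fin)
open import Data.List using (List; []; _∷_; map; concatMap; allFin; filter; length)
open import Data.List.Relation.Unary.All using (All)
open import Data.Product using (Σ; _×_; _,_; ∃; ∃-syntax)
open import Relation.Binary.PropositionalEquality using (_≡_)
open import Relation.Nullary using (¬_)
open import Function.Definitions using (Injective)

record ThreeGraph (n : ℕ) : Set where
  field
    edge     : Fin n → Fin n → Fin n → Bool
    sym₁₂    : ∀ a b c → edge a b c ≡ edge b a c
    sym₂₃    : ∀ a b c → edge a b c ≡ edge a c b
    loopless : ∀ a c → edge a a c ≡ false
open ThreeGraph public

countTrue : List Bool → ℕ
countTrue [] = 0
countTrue (true ∷ bs) = suc (countTrue bs)
countTrue (false ∷ bs) = countTrue bs

codeg : ∀ {n} → ThreeGraph n → Fin n → Fin n → ℕ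
codeg {n} H u v = countTrue (map (edge H u v) (allFin n))

minPos : List ℕ → ℕ
minPos [] = 0
minPos (zero ∷ xs) = minPos xs
minPos (suc k ∷ xs) with minPos xs
... | zero = suc k
... | suc m = suc k ⊓ suc m

-- minimum positive co-degree δ₂⁺(H): minimum of codeg over pairs lying in
-- some edge (i.e. pairs with positive co-degree); 0 for edgeless H.
δ₂⁺ : ∀ {n} → ThreeGraph n → ℕ
δ₂⁺ {n} H = minPos (concatMap (λ u → map (codeg H u) (allFin n)) (allFin n))

Contains : ∀ {n m} → ThreeGraph n → ThreeGraph m → Set
Contains {n} {m} H F =
  Σ (Fin m → Fin n) λ φ → Injective _≡_ _≡_ φ ×
    (∀ a b c → edge F a b c ≡ true → edge H (φ a) (φ b) (φ c) ≡ true)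

-- γ⁺(F) = p / q, unfolding co⁺ex(n,F) = max of δ₂⁺ over F-free n-vertex H
-- and the limit co⁺ex(n,F)/n → p/q: for every ε = 1/(k+1) there is N such
-- that for all n ≥ N,
--   (i)  some F-free H on n vertices has δ₂⁺(H) ≥ (p/q − ε) n, and
--   (ii) every F-free H on n vertices has δ₂⁺(H) ≤ (p/q + ε) n.
-- (multiplied through by q(k+1) to stay in ℕ)
GammaPlusIs : ∀ {m} → ThreeGraph m → ℕ → ℕ → Set
GammaPlusIs F p q =
  ∀ (k : ℕ) → ∃[ N ] ∀ n → N ≤ n →
    (Σ (ThreeGraph n) λ H → ¬ Contains H F ×
        p * suc k * n ≤ q * suc k * δ₂⁺ H + q * n)
    × (∀ (H : ThreeGraph n) → ¬ Contains H F →
        q * suc k * δ₂⁺ H ≤ p * suc k * n + q * n)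

-- F_{4,2} on {1..6} (here Fin 6 = {0..5}), edges
-- 123,124,134,156,256,356,456 ↦ 012,013,023,045,145,245,345.
isF42 : Fin 6 → Fin 6 → Fin 6 → Bool
isF42 a b c = memb (Data.Fin.toℕ a , Data.Fin.toℕ b , Data.Fin.toℕ c)
  where
  open import Data.Nat using (_≡ᵇ_)
  open import Data.Bool using (_∧_; _∨_)
  eqT : ℕ × ℕ × ℕ → ℕ × ℕ × ℕ → Bool
  eqT (x , y , z) (x' , y' , z') = (x ≡ᵇ x') ∧ (y ≡ᵇ y') ∧ (z ≡ᵇ z')
  perms : ℕ × ℕ × ℕ → List (ℕ × ℕ × ℕ)
  perms (x , y , z) = (x , y , z) ∷ (x , z , y) ∷ (y , x , z) ∷ (y , z , x) ∷ (z , x , y) ∷ (z , y , x) ∷ []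
  edgesF : List (ℕ × ℕ × ℕ)
  edgesF = (0 , 1 , 2) ∷ (0 , 1 , 3) ∷ (0 , 2 , 3) ∷ (0 , 4 , 5) ∷ (1 , 4 , 5) ∷ (2 , 4 , 5) ∷ (3 , 4 , 5) ∷ []
  anyL : List Bool → Bool
  anyL [] = false
  anyL (b ∷ bs) = b ∨ anyL bs
  memb : ℕ × ℕ × ℕ → Bool
  memb t = anyL (concatMap (λ e → map (eqT t) (perms e)) edgesF)

private
  open import Data.Fin.Properties using (all?)
  open import Data.Bool.Properties using () renaming (_≟_ to _≟ᵇ_)
  open import Relation.Nullary.Decidable using (toWitness)
  open import Data.Unit using (tt)

  dec3 : (f g : Fin 6 → Fin 6 → Fin 6 → Bool) → _
  dec3 f g = all? λ a → all? λ b → all? λ c → f a b c ≟ᵇ g a b c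

F₄₂ : ThreeGraph 6
F₄₂ = record
  { edge = isF42
  ; sym₁₂ = toWitness {a? = dec3 isF42 (λ a b c → isF42 b a c)} tt
  ; sym₂₃ = toWitness {a? = dec3 isF42 (λ a b c → isF42 a c b)} tt
  ; loopless = toWitness {a? = all? λ a → all? λ c → isF42 a a c ≟ᵇ false} tt
  }

{-# OPTIONS --safe #-}
-- Lower bound: F₄₂ covers pairs (any two of its vertices lie in a common edge),
-- so the complete 5-partite 3-graph contains no copy of F₄₂, and its positive
-- codegrees are about 3n/5.
-- Upper bound: let δ = δ₂⁺ H and suppose 3n < 5δ.  As n < 2δ, every non-empty
-- link N(x,y) spans an edge wvc.  The codegree of xy counted twice, plus those
-- of wv, wc and vc, is at least 5δ > 3n, so some d is counted at least four
-- times: d lies in N(x,y) and forms an edge with two of the pairs of wvc.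
-- Then w, v, c, d span a K₄⁻ inside N(x,y), which is a copy of F₄₂.
module Submission where

open import Defs
open import Data.Bool using (Bool; true; false; not; _∧_)
open import Data.Bool.Properties using () renaming (_≟_ to _≟ᵇ_)
open import Data.Empty using (⊥-elim)
open import Data.Fin using (Fin; zero; suc; toℕ; #_)
open import Data.Fin.Properties using (all?; any?; pigeonhole) renaming (_≟_ to _≟ᶠ_)
open import Data.List using (List; []; _∷_; map; concatMap; allFin; length; tabulate; _++_)
open import Data.List.Membership.Propositional using (_∈_; lose)
open import Data.List.Membership.Propositional.Properties
  using (∈-map⁺; ∈-map⁻; ∈-concatMap⁺; ∈-concatMap⁻; ∈-allFin)
open import Data.List.Properties using (length-tabulate; map-tabulate)
open import Data.List.Relation.Unary.All as All using (All; []; _∷_)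
open import Data.List.Relation.Unary.Any as Any using (Any; here; there; satisfied)
open import Data.Nat using (ℕ; zero; suc; _+_; _*_; _≤_; _<_; z≤n; s≤s; z<s; _<?_)
open import Data.Nat.ListAction using (sum)
open import Data.Nat.Properties
open import Algebra.Properties.CommutativeSemigroup +-commutativeSemigroup using (x∙yz≈y∙xz)
open import Data.Nat.Tactic.RingSolver using (solve-∀)
open import Data.Product using (_×_; _,_; ∃-syntax; proj₁; proj₂)
open import Data.Product.Properties using (≡-dec)
open import Data.Sum using (_⊎_; inj₁; inj₂)
open import Data.Unit using (tt)
open import Data.Vec using ([]; _∷_; lookup)
open import Function using (_∘_; id)
open import Function.Definitions using (Injective)
open import Relation.Binary.PropositionalEquality
open import Relation.Nullary using (¬_; yes; no)
open import Relation.Nullary.Decidable using (toWitness; ⌊_⌋; _→-dec_; ¬?)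

open ≤-Reasoning

private variable
  A : Set
  n m : ℕ

-- Minimum positive entry of a list.

minPos-∈ : ∀ xs → 0 < minPos xs → minPos xs ∈ xs
minPos-∈ (zero ∷ xs) p = there (minPos-∈ xs p)
minPos-∈ (suc k ∷ xs) p with minPos xs in eq
... | zero = here refl
... | suc l with ⊓-sel (suc k) (suc l)
...   | inj₁ e = here e
...   | inj₂ e = there (subst (_∈ xs) (trans eq (sym e)) (minPos-∈ xs (subst (0 <_) (sym eq) z<s)))

minPos-bounds : ∀ {x} xs → x ∈ xs → 0 < x → 0 < minPos xs × minPos xs ≤ x
minPos-bounds (zero ∷ xs) (here refl) ()
minPos-bounds (zero ∷ xs) (there x∈) p = minPos-bounds xs x∈ p
minPos-bounds (suc k ∷ xs) (here refl) p with minPos xs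
... | zero = z<s , ≤-refl
... | suc l = z<s , m⊓n≤m (suc k) (suc l)
-- The recursive call also gives `0 < minPos xs`, which excludes the default value `zero`.
minPos-bounds (suc k ∷ xs) (there x∈) p with minPos xs | minPos-bounds xs x∈ p
... | suc l | _ , le = z<s , ≤-trans (m⊓n≤n (suc k) (suc l)) le

-- Double counting and the pigeonhole principle.

count : (A → Bool) → List A → ℕ
count f xs = countTrue (map f xs)

count-pos : ∀ (f : A → Bool) {x xs} → x ∈ xs → f x ≡ true → 0 < count f xs
count-pos f (here refl) fx rewrite fx = z<s
count-pos f {xs = y ∷ _} (there x∈) fx with f y
... | true = z<s
... | false = count-pos f x∈ fx

sum-count-∷ : ∀ (fs : List (A → Bool)) x xs →
  sum (map (λ f → count f (x ∷ xs)) fs) ≡ count (λ f → f x) fs + sum (map (λ f → count f xs) fs)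
sum-count-∷ [] x xs = refl
sum-count-∷ (f ∷ fs) x xs with f x
... | true  = cong suc (trans (cong (count f xs +_) (sum-count-∷ fs x xs))
    (x∙yz≈y∙xz (count f xs) (count (λ g → g x) fs) _))
... | false = trans (cong (count f xs +_) (sum-count-∷ fs x xs))
    (x∙yz≈y∙xz (count f xs) (count (λ g → g x) fs) _)

-- Summing over elements instead of predicates, some element must exceed the average `k`. A head
-- satisfying at most `k` predicates can be removed without losing the strict inequality. A
-- predicate listed twice counts with weight two.
count-pigeonhole : ∀ k (fs : List (A → Bool)) xs →
  k * length xs < sum (map (λ f → count f xs) fs) → ∃[ x ] k < count (λ f → f x) fs
count-pigeonhole k fs [] p = ⊥-elim (n≮0 (subst (k * 0 <_) (sum-zero fs) p))
  where
  sum-zero : ∀ (gs : List (A → Bool)) → sum (map (λ g → count g []) gs) ≡ 0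
  sum-zero [] = refl
  sum-zero (_ ∷ gs) = sum-zero gs
count-pigeonhole k fs (x ∷ xs) p with k <? count (λ f → f x) fs
... | yes k<x = x , k<x
... | no k≮x = count-pigeonhole k fs xs (+-cancelˡ-< k _ _ (begin-strict
    k + k * length xs                                        ≡⟨ *-suc k (length xs) ⟨
    k * suc (length xs)                                      <⟨ p ⟩
    sum (map (λ f → count f (x ∷ xs)) fs)                    ≡⟨ sum-count-∷ fs x xs ⟩
    count (λ f → f x) fs + sum (map (λ f → count f xs) fs)   ≤⟨ +-monoˡ-≤ _ (≮⇒≥ k≮x) ⟩
    k + sum (map (λ f → count f xs) fs)                      ∎))

fin-pigeonhole : ∀ k (fs : List (Fin n → Bool)) →
  k * n < sum (map (λ f → count f (allFin n)) fs) → ∃[ x ] k < count (λ f → f x) fs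
fin-pigeonhole {n} k fs p =
  count-pigeonhole k fs (allFin n)
    (subst (λ l → k * l < sum (map (λ f → count f (allFin n)) fs)) (sym (length-tabulate id)) p)

-- Edges and positive codegrees.

Edge : ThreeGraph n → Fin n → Fin n → Fin n → Set
Edge H a b c = edge H a b c ≡ true

module _ (H : ThreeGraph n) where

  swap₁₂ : ∀ {a b c} → Edge H a b c → Edge H b a c
  swap₁₂ e = trans (sym (sym₁₂ H _ _ _)) e

  swap₂₃ : ∀ {a b c} → Edge H a b c → Edge H a c b
  swap₂₃ e = trans (sym (sym₂₃ H _ _ _)) e

  edge-irrefl : ∀ {a c} → ¬ Edge H a a c
  edge-irrefl e with () ← trans (sym e) (loopless H _ _)

  codegrees : List ℕ
  codegrees = concatMap (λ u → map (codeg H u) (allFin n)) (allFin n)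

  codeg∈codegrees : ∀ u v → codeg H u v ∈ codegrees
  codeg∈codegrees u v =
    ∈-concatMap⁺ (λ u → map (codeg H u) (allFin n)) (lose (∈-allFin u) (∈-map⁺ (codeg H u) (∈-allFin v)))

  δ₂⁺-bounds : ∀ {u v w} → Edge H u v w → 0 < δ₂⁺ H × δ₂⁺ H ≤ codeg H u v
  δ₂⁺-bounds {u} {v} {w} e =
    minPos-bounds codegrees (codeg∈codegrees u v) (count-pos (edge H u v) (∈-allFin w) e)

  δ₂⁺-attained : 0 < δ₂⁺ H → ∃[ u ] ∃[ v ] δ₂⁺ H ≡ codeg H u v
  δ₂⁺-attained p
    with satisfied (∈-concatMap⁻ (λ u → map (codeg H u) (allFin n)) {xs = allFin n} (minPos-∈ codegrees p))
  ... | u , δ∈ with v , _ , eq ← ∈-map⁻ (codeg H u) δ∈ = u , v , eq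

  codeg-witness : ∀ {u v} → 0 < codeg H u v → ∃[ w ] Edge H u v w
  codeg-witness {u} {v} p
    with w , q ← fin-pigeonhole 0 (edge H u v ∷ []) (subst (0 <_) (sym (+-identityʳ _)) p)
    with edge H u v w in e | q
  ... | true | _ = w , e

  -- A pair attaining the minimum has positive codegree, so it extends to an edge.
  δ₂⁺-edge : 0 < δ₂⁺ H → ∃[ u ] ∃[ v ] ∃[ w ] (δ₂⁺ H ≡ codeg H u v × Edge H u v w)
  δ₂⁺-edge p with u , v , eq ← δ₂⁺-attained p
    with w , e ← codeg-witness (subst (0 <_) eq p) = u , v , w , eq , e

  -- Each of the two links has more than `n / 2` vertices, so they intersect.
  common-neighbour : n < δ₂⁺ H + δ₂⁺ H → ∀ {a b c p q r} → Edge H a b c → Edge H p q r →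
    ∃[ z ] (Edge H a b z × Edge H p q z)
  common-neighbour large {a} {b} {p = p} {q} e₁ e₂
    with z , h ← fin-pigeonhole 1 (edge H a b ∷ edge H p q ∷ []) (begin-strict
      1 * n                               ≡⟨ *-identityˡ n ⟩
      n                                   <⟨ large ⟩
      δ₂⁺ H + δ₂⁺ H                       ≤⟨ +-mono-≤ (proj₂ (δ₂⁺-bounds e₁)) (proj₂ (δ₂⁺-bounds e₂)) ⟩
      codeg H a b + codeg H p q           ≡⟨ cong (codeg H a b +_) (+-identityʳ _) ⟨
      codeg H a b + (codeg H p q + 0)     ∎)
    with edge H a b z in f₁ | edge H p q z in f₂ | h
  ... | true | true | _ = z , f₁ , f₂
  ... | true | false | s≤s ()
  ... | false | true | s≤s ()

-- Homomorphisms and copies of `F₄₂`.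

CoversPairs : ThreeGraph m → Set
CoversPairs {m} F = ∀ (i j : Fin m) → i ≢ j → ∃[ k ] Edge F i j k

Homomorphic : (F : ThreeGraph m) (H : ThreeGraph n) → (Fin m → Fin n) → Set
Homomorphic F H φ = ∀ a b c → Edge F a b c → Edge H (φ a) (φ b) (φ c)

-- Two vertices with the same image would lie in an edge of `F` whose image repeats a vertex.
hom-injective : (F : ThreeGraph m) (H : ThreeGraph n) → CoversPairs F →
  ∀ {φ} → Homomorphic F H φ → Injective _≡_ _≡_ φ
hom-injective F H cov {φ} hom {i} {j} eq with i ≟ᶠ j
... | yes i≡j = i≡j
... | no i≢j with k , e ← cov i j i≢j =
  ⊥-elim (edge-irrefl H (subst (λ z → Edge H z (φ j) (φ k)) eq (hom i j k e)))

F₄₂-coversPairs : CoversPairs F₄₂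
F₄₂-coversPairs = toWitness
  {a? = all? λ i → all? λ j → ¬? (i ≟ᶠ j) →-dec any? λ k → isF42 i j k ≟ᵇ true} tt

Triple : ℕ → Set
Triple m = Fin m × Fin m × Fin m

orderings : Triple m → List (Triple m)
orderings (x , y , z) =
  (x , y , z) ∷ (x , z , y) ∷ (y , x , z) ∷ (y , z , x) ∷ (z , x , y) ∷ (z , y , x) ∷ []

F₄₂-edges : List (Triple 6)
F₄₂-edges =
    (# 0 , # 1 , # 2) ∷ (# 0 , # 1 , # 3) ∷ (# 0 , # 2 , # 3)
  ∷ (# 0 , # 4 , # 5) ∷ (# 1 , # 4 , # 5) ∷ (# 2 , # 4 , # 5) ∷ (# 3 , # 4 , # 5) ∷ []

-- Turns the Boolean test `isF42` into seven explicit triples, so that a homomorphism need only be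
-- checked on these. Proved by evaluation over all triples.
F₄₂-edge-list : ∀ a b c → Edge F₄₂ a b c → Any (λ e → (a , b , c) ∈ orderings e) F₄₂-edges
F₄₂-edge-list = toWitness
  {a? = all? λ a → all? λ b → all? λ c → (isF42 a b c ≟ᵇ true) →-dec
          Any.any? (λ e → Any.any? (λ t → ≡-dec _≟ᶠ_ (≡-dec _≟ᶠ_ _≟ᶠ_) (a , b , c) t) (orderings e)) F₄₂-edges} tt

F₄₂-hom : (H : ThreeGraph n) (φ : Fin 6 → Fin n) →
  All (λ (i , j , k) → Edge H (φ i) (φ j) (φ k)) F₄₂-edges → Homomorphic F₄₂ H φ
F₄₂-hom H φ es a b c e = go es (F₄₂-edge-list a b c e)
  where
  reorder : ∀ {i j k} → Edge H (φ i) (φ j) (φ k) →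
    All (λ (p , q , r) → Edge H (φ p) (φ q) (φ r)) (orderings (i , j , k))
  reorder e = e ∷ swap₂₃ H e ∷ swap₁₂ H e ∷ swap₂₃ H (swap₁₂ H e)
    ∷ swap₁₂ H (swap₂₃ H e) ∷ swap₁₂ H (swap₂₃ H (swap₁₂ H e)) ∷ []
  go : ∀ {ts} → All (λ (i , j , k) → Edge H (φ i) (φ j) (φ k)) ts →
    Any (λ t → (a , b , c) ∈ orderings t) ts → Edge H (φ a) (φ b) (φ c)
  go (e ∷ _) (here t∈) = All.lookup (reorder e) t∈
  go (_ ∷ es) (there t∈) = go es t∈

-- The first three edges form a K₄⁻ with apex `a`, the other four put it inside the link of `x y`.
-- The six vertices are distinct by `hom-injective`.
contains-F₄₂ : (H : ThreeGraph n) → ∀ {a b c d x y} →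
  Edge H a b c → Edge H a b d → Edge H a c d →
  Edge H x y a → Edge H x y b → Edge H x y c → Edge H x y d → Contains H F₄₂
contains-F₄₂ {n} H {a} {b} {c} {d} {x} {y} abc abd acd xya xyb xyc xyd =
  φ , hom-injective F₄₂ H F₄₂-coversPairs hom , hom
  where
  φ : Fin 6 → Fin n
  φ = lookup (a ∷ b ∷ c ∷ d ∷ x ∷ y ∷ [])
  front : ∀ {z} → Edge H x y z → Edge H z x y
  front e = swap₁₂ H (swap₂₃ H e)
  hom : Homomorphic F₄₂ H φ
  hom = F₄₂-hom H φ (abc ∷ abd ∷ acd ∷ front xya ∷ front xyb ∷ front xyc ∷ front xyd ∷ [])

-- Upper bound.

TwoOf : Bool → Bool → Bool → Set
TwoOf p q r = p ≡ true × q ≡ true ⊎ p ≡ true × r ≡ true ⊎ q ≡ true × r ≡ true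

-- Without `b` the count is at most three; with it, `b` contributes two and the rest must contribute
-- at least two.
four-of-five : ∀ b p q r → 3 < countTrue (b ∷ b ∷ p ∷ q ∷ r ∷ []) → b ≡ true × TwoOf p q r
four-of-five true true true _ _ = refl , inj₁ (refl , refl)
four-of-five true true false true _ = refl , inj₂ (inj₁ (refl , refl))
four-of-five true false true true _ = refl , inj₂ (inj₂ (refl , refl))
four-of-five true true false false (s≤s (s≤s (s≤s ())))
four-of-five true false true false (s≤s (s≤s (s≤s ())))
four-of-five true false false true (s≤s (s≤s (s≤s ())))
four-of-five true false false false (s≤s (s≤s ()))
four-of-five false true true true (s≤s (s≤s (s≤s ())))
four-of-five false true true false (s≤s (s≤s ()))
four-of-five false true false true (s≤s (s≤s ()))
four-of-five false true false false (s≤s ())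
four-of-five false false true true (s≤s (s≤s ()))
four-of-five false false true false (s≤s ())
four-of-five false false false true (s≤s ())

large-δ₂⁺⇒contains : (H : ThreeGraph n) → 3 * n < 5 * δ₂⁺ H → Contains H F₄₂
large-δ₂⁺⇒contains {n} H large = extend (δ₂⁺-edge H (*-cancelˡ-< 5 0 (δ₂⁺ H) (≤-<-trans z≤n large)))
  where
  assoc : ∀ a → 5 * a + a ≡ 3 * (a + a)
  assoc = solve-∀
  n<2δ : n < δ₂⁺ H + δ₂⁺ H
  n<2δ = *-cancelˡ-< 3 n (δ₂⁺ H + δ₂⁺ H) (begin-strict
    3 * n                   <⟨ large ⟩
    5 * δ₂⁺ H               ≤⟨ m≤m+n _ _ ⟩
    5 * δ₂⁺ H + δ₂⁺ H       ≡⟨ assoc (δ₂⁺ H) ⟩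
    3 * (δ₂⁺ H + δ₂⁺ H)     ∎)
  bound : ∀ {p q r} → Edge H p q r → δ₂⁺ H ≤ codeg H p q
  bound e = proj₂ (δ₂⁺-bounds H e)
  -- The apex of the K₄⁻ is the vertex shared by the two pairs that form an edge with `d`: `w`, `v`
  -- or `c` in the three cases.
  finish : ∀ {x y w v c d} → Edge H x y w → Edge H x y v → Edge H x y c → Edge H w v c →
    Edge H x y d × TwoOf (edge H w v d) (edge H w c d) (edge H v c d) → Contains H F₄₂
  finish xyw xyv xyc wvc (xyd , inj₁ (wvd , wcd)) = contains-F₄₂ H wvc wvd wcd xyw xyv xyc xyd
  finish xyw xyv xyc wvc (xyd , inj₂ (inj₁ (wvd , vcd))) =
    contains-F₄₂ H (swap₁₂ H wvc) (swap₁₂ H wvd) vcd xyv xyw xyc xyd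
  finish xyw xyv xyc wvc (xyd , inj₂ (inj₂ (wcd , vcd))) =
    contains-F₄₂ H (swap₁₂ H (swap₂₃ H wvc)) (swap₁₂ H wcd) (swap₁₂ H vcd) xyc xyw xyv xyd
  extend : ∃[ x ] ∃[ y ] ∃[ w ] (δ₂⁺ H ≡ codeg H x y × Edge H x y w) → Contains H F₄₂
  extend (x , y , w , _ , xyw) =
    -- First `v` is taken in the links of `x y` and `x w`. Then `w v` lies in an edge, so its link
    -- meets that of `x y` in some `c`.
    let v , xyv , xwv = common-neighbour H n<2δ xyw (swap₂₃ H xyw)
        c , xyc , wvc = common-neighbour H n<2δ xyw (swap₂₃ H (swap₁₂ H xwv))
        -- Every listed pair lies in an edge, so the five codegrees sum to at least `5 * δ₂⁺ H`. The
        -- double weight of `x y` forces `d` into its link.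
        d , h = fin-pigeonhole 3 (edge H x y ∷ edge H x y ∷ edge H w v ∷ edge H w c ∷ edge H v c ∷ [])
          (<-≤-trans large (+-mono-≤ (bound xyw) (+-mono-≤ (bound xyw) (+-mono-≤ (bound wvc)
            (+-mono-≤ (bound (swap₂₃ H wvc)) (+-mono-≤ (bound (swap₂₃ H (swap₁₂ H wvc))) (z≤n {0})))))))
    in finish xyw xyv xyc wvc (four-of-five (edge H x y d) _ _ _ h)

-- Lower bound: the balanced complete 5-partite 3-graph.

-- The residue modulo 5, by a recursion that removes five vertices at a time, as the induction in
-- `rainbow-count` does.
colour : ℕ → Fin 5
colour 0 = # 0
colour 1 = # 1
colour 2 = # 2
colour 3 = # 3
colour 4 = # 4
colour (suc (suc (suc (suc (suc n))))) = colour n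

-- The complete 3-graph on five vertices, of which `fivePartite` is a blow-up. Its properties are
-- thus finite checks on colours.
rainbow : Fin 5 → Fin 5 → Fin 5 → Bool
rainbow a b c = not ⌊ a ≟ᶠ b ⌋ ∧ not ⌊ a ≟ᶠ c ⌋ ∧ not ⌊ b ≟ᶠ c ⌋

rainbow-sym₁₂ : ∀ a b c → rainbow a b c ≡ rainbow b a c
rainbow-sym₁₂ = toWitness {a? = all? λ a → all? λ b → all? λ c → rainbow a b c ≟ᵇ rainbow b a c} tt

rainbow-sym₂₃ : ∀ a b c → rainbow a b c ≡ rainbow a c b
rainbow-sym₂₃ = toWitness {a? = all? λ a → all? λ b → all? λ c → rainbow a b c ≟ᵇ rainbow a c b} tt

rainbow-loopless : ∀ a c → rainbow a a c ≡ false
rainbow-loopless = toWitness {a? = all? λ a → all? λ c → rainbow a a c ≟ᵇ false} tt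

fivePartite : ∀ n → ThreeGraph n
fivePartite n = record
  { edge     = λ a b c → rainbow (col a) (col b) (col c)
  ; sym₁₂    = λ a b c → rainbow-sym₁₂ (col a) (col b) (col c)
  ; sym₂₃    = λ a b c → rainbow-sym₂₃ (col a) (col b) (col c)
  ; loopless = λ a c → rainbow-loopless (col a) (col c)
  }
  where
  col : Fin n → Fin 5
  col = colour ∘ toℕ

-- Two of the six vertices of a copy share one of the five colours, yet they lie in a common edge.
fivePartite-F₄₂-free : ∀ n → ¬ Contains (fivePartite n) F₄₂
fivePartite-F₄₂-free n (φ , _ , hom) =
  let i , j , i<j , eq = pigeonhole ≤-refl col
      k , e = F₄₂-coversPairs i j (λ i≡j → <⇒≢ i<j (cong toℕ i≡j))
  in rainbow-irrefl (col k) eq (hom i j k e)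
  where
  col : Fin 6 → Fin 5
  col = colour ∘ toℕ ∘ φ
  rainbow-irrefl : ∀ {a b} c → a ≡ b → rainbow a b c ≢ true
  rainbow-irrefl {a} c refl e with () ← trans (sym e) (rainbow-loopless a c)

-- The source of the density 3/5: two distinct colours leave three of five, so each block of five
-- vertices adds three to the codegree.
rainbow-completions : ∀ a b c → rainbow a b c ≡ true → count (rainbow a b) (allFin 5) ≡ 3
rainbow-completions = toWitness
  {a? = all? λ a → all? λ b → all? λ c → (rainbow a b c ≟ᵇ true) →-dec (count (rainbow a b) (allFin 5) ≟ 3)} tt

countTrue-++ : ∀ bs cs → countTrue (bs ++ cs) ≡ countTrue bs + countTrue cs
countTrue-++ [] cs = refl
countTrue-++ (true ∷ bs) cs = cong suc (countTrue-++ bs cs)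
countTrue-++ (false ∷ bs) cs = countTrue-++ bs cs

-- 12 = 3 · 4 accounts for the at most four vertices outside complete blocks of five.
rainbow-count : ∀ a b c → rainbow a b c ≡ true → ∀ n →
  3 * n ≤ 5 * countTrue (tabulate {n = n} (rainbow a b ∘ colour ∘ toℕ)) + 12
rainbow-count a b c abc 0 = z≤n
rainbow-count a b c abc 1 = ≤-trans (m≤m+n 3 9) (m≤n+m 12 _)
rainbow-count a b c abc 2 = ≤-trans (m≤m+n 6 6) (m≤n+m 12 _)
rainbow-count a b c abc 3 = ≤-trans (m≤m+n 9 3) (m≤n+m 12 _)
rainbow-count a b c abc 4 = m≤n+m 12 _
rainbow-count a b c abc (suc (suc (suc (suc (suc n))))) = begin
  3 * (5 + n)                 ≡⟨ *-distribˡ-+ 3 5 n ⟩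
  15 + 3 * n                  ≤⟨ +-monoʳ-≤ 15 (rainbow-count a b c abc n) ⟩
  15 + (5 * t + 12)           ≡⟨ regroup t ⟩
  5 * (3 + t) + 12            ≡⟨ cong (λ s → 5 * (s + t) + 12) (rainbow-completions a b c abc) ⟨
  5 * (count (rainbow a b) (allFin 5) + t) + 12
    ≡⟨ cong (λ s → 5 * s + 12) (countTrue-++ (map (rainbow a b) (allFin 5)) _) ⟨
  5 * countTrue (tabulate {n = 5 + n} (rainbow a b ∘ colour ∘ toℕ)) + 12   ∎
  where
  t = countTrue (tabulate {n = n} (rainbow a b ∘ colour ∘ toℕ))
  regroup : ∀ t → 15 + (5 * t + 12) ≡ 5 * (3 + t) + 12
  regroup = solve-∀

fivePartite-codeg : ∀ {u v w} → Edge (fivePartite n) u v w → 3 * n ≤ 5 * codeg (fivePartite n) u v + 12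
fivePartite-codeg {n} {u} {v} {w} e = subst (λ bs → 3 * n ≤ 5 * countTrue bs + 12)
  (sym (map-tabulate id (edge (fivePartite n) u v)))
  (rainbow-count (colour (toℕ u)) (colour (toℕ v)) (colour (toℕ w)) e n)

fivePartite-edge : 3 ≤ n → ∃[ u ] ∃[ v ] ∃[ w ] Edge (fivePartite n) u v w
fivePartite-edge (s≤s (s≤s (s≤s _))) = zero , suc zero , suc (suc zero) , refl

-- With three vertices there is an edge, so `δ₂⁺` is not the default 0 but the codegree of a pair in
-- an edge.
fivePartite-δ₂⁺ : ∀ n → 3 ≤ n → 3 * n ≤ 5 * δ₂⁺ (fivePartite n) + 12
fivePartite-δ₂⁺ n 3≤n =
  let u₀ , v₀ , w₀ , e₀ = fivePartite-edge 3≤n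
      0<δ = proj₁ (δ₂⁺-bounds (fivePartite n) {u₀} {v₀} {w₀} e₀)
      u , v , w , eq , e = δ₂⁺-edge (fivePartite n) 0<δ
  in subst (λ d → 3 * n ≤ 5 * d + 12) (sym eq) (fivePartite-codeg {u = u} {v} {w} e)

-- Passage to the limit.

*-middle : ∀ a b c → a * b * c ≡ b * (a * c)
*-middle = solve-∀

theorem2p5 : GammaPlusIs F₄₂ 3 5
-- The additive error 12 becomes `12 * suc k` after scaling, and this threshold lets `5 * n` absorb
-- it.
theorem2p5 k = 12 * suc k , λ n N≤n →
    (fivePartite n , fivePartite-F₄₂-free n , lower n N≤n)
  , λ H free → upper H (≮⇒≥ (λ large → free (large-δ₂⁺⇒contains H large)))
  where
  lower : ∀ n → 12 * suc k ≤ n → 3 * suc k * n ≤ 5 * suc k * δ₂⁺ (fivePartite n) + 5 * n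
  lower n N≤n = begin
    3 * suc k * n                   ≡⟨ *-middle 3 (suc k) n ⟩
    suc k * (3 * n)                 ≤⟨ *-monoʳ-≤ (suc k) (fivePartite-δ₂⁺ n 3≤n) ⟩
    suc k * (5 * δ + 12)            ≡⟨ *-distribˡ-+ (suc k) (5 * δ) 12 ⟩
    suc k * (5 * δ) + suc k * 12    ≡⟨ cong₂ _+_ (sym (*-middle 5 (suc k) δ)) (*-comm (suc k) 12) ⟩
    5 * suc k * δ + 12 * suc k      ≤⟨ +-monoʳ-≤ _ (≤-trans N≤n (m≤n*m n 5)) ⟩
    5 * suc k * δ + 5 * n           ∎
    where
    δ = δ₂⁺ (fivePartite n)
    3≤n : 3 ≤ n
    3≤n = ≤-trans (*-mono-≤ {3} {12} {1} (m≤m+n 3 9) (s≤s z≤n)) N≤n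
  upper : ∀ {n} (H : ThreeGraph n) → 5 * δ₂⁺ H ≤ 3 * n → 5 * suc k * δ₂⁺ H ≤ 3 * suc k * n + 5 * n
  upper {n} H small = begin
    5 * suc k * δ₂⁺ H        ≡⟨ *-middle 5 (suc k) (δ₂⁺ H) ⟩
    suc k * (5 * δ₂⁺ H)      ≤⟨ *-monoʳ-≤ (suc k) small ⟩
    suc k * (3 * n)          ≡⟨ *-middle 3 (suc k) n ⟨
    3 * suc k * n            ≤⟨ m≤m+n _ _ ⟩
    3 * suc k * n + 5 * n    ∎
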